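{- Let $p$ and $q$ be distinct primes with $p>q$. Then, as polynomials in the indeterminate $X$ with integer coefficients, $$\Phi_{pq}(X) = 1+(X-1)\sum_{i=0}^{q-1}\sum_{j=1}^{\lfloor pi/q\rfloor}X^{pi - qj}.$$
   Context: $\Phi_n(X)$ denotes the $n$-th cyclotomic polynomial. $\lfloor x\rfloor$ denotes the floor of $x$; an inner sum whose upper limit is $0$ is empty (equal to $0$). -}

module Defs where

open import Data.Nat as ℕ using (ℕ; zero; suc; _≤?_)
open import Data.Nat.DivMod using (_/_)
open import Data.Nat.Divisibility using (_∣?_)
open import Data.Integer as ℤ using (ℤ; +_; -_)
open import Data.List using (List; []; _∷_; [_]; _++_; replicate; reverse; length; map; foldr; upTo; filter)
open import Relation.Nullary using (yes; no)
open import Relation.Binary.PropositionalEquality using (_≡_)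

-- Polynomials over ℤ as coefficient lists, lowest degree first.
-- Trailing zeros are allowed; equality is coefficientwise (_≈ₚ_).

Poly : Set
Poly = List ℤ

coeff : Poly → ℕ → ℤ
coeff []      _       = + 0
coeff (a ∷ _) zero    = a
coeff (_ ∷ p) (suc k) = coeff p k

infix 4 _≈ₚ_
_≈ₚ_ : Poly → Poly → Set
p ≈ₚ q = ∀ k → coeff p k ≡ coeff q k

infixl 6 _⊕_ _⊖_
infixl 7 _⊛_

_⊕_ : Poly → Poly → Poly
[]      ⊕ q       = q
(a ∷ p) ⊕ []      = a ∷ p
(a ∷ p) ⊕ (b ∷ q) = (a ℤ.+ b) ∷ (p ⊕ q)

scale : ℤ → Poly → Poly
scale c = map (c ℤ.*_)

_⊖_ : Poly → Poly → Poly
p ⊖ q = p ⊕ scale (- + 1) q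

_⊛_ : Poly → Poly → Poly
[]      ⊛ q = []
(a ∷ p) ⊛ q = scale a q ⊕ (+ 0 ∷ (p ⊛ q))

C : ℤ → Poly
C c = [ c ]

one : Poly
one = C (+ 1)

X^ : ℕ → Poly
X^ k = replicate k (+ 0) ++ [ + 1 ]

X : Poly
X = X^ 1

polySum : List Poly → Poly
polySum = foldr _⊕_ []

polyProd : List Poly → Poly
polyProd = foldr _⊛_ one

-- Exact division by a monic polynomial (long division; remainder dropped).

private
  dropZeros : List ℤ → List ℤ
  dropZeros []       = []
  dropZeros (+ 0 ∷ xs) = dropZeros xs
  dropZeros (x ∷ xs) = x ∷ xs

  -- subtract x·bt from the prefix of rest (high-degree-first lists)
  sub : ℤ → List ℤ → List ℤ → List ℤ
  sub x []       rest     = rest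
  sub x (_ ∷ _)  []       = []
  sub x (b ∷ bt) (r ∷ rs) = (r ℤ.- x ℤ.* b) ∷ sub x bt rs

  -- synthetic division by (1 ∷ bt), high-degree-first, with fuel
  quotH : ℕ → List ℤ → List ℤ → List ℤ
  quotH zero    bt _          = []
  quotH (suc f) bt []         = []
  quotH (suc f) bt (x ∷ rest) with length bt ≤? length rest
  ... | yes _ = x ∷ quotH f bt (sub x bt rest)
  ... | no  _ = []

-- quotient of a by b, meaningful when b is monic (leading coefficient 1)
divMonic : Poly → Poly → Poly
divMonic a b with dropZeros (reverse b)
... | + 1 ∷ bt = reverse (quotH (length a) bt (dropZeros (reverse a)))
... | _        = []

-- Cyclotomic polynomials, via  X^n - 1 = ∏_{d ∣ n} Φ_d(X),
-- i.e. Φ_n = (X^n - 1) / ∏_{d ∣ n, d < n} Φ_d.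

properDivisors : ℕ → List ℕ
properDivisors n = filter (λ d → d ∣? n) (upTo n)

private
  cycF : ℕ → ℕ → Poly
  cycF zero    n = one
  cycF (suc f) n = divMonic (X^ n ⊖ one) (polyProd (map (cycF f) (properDivisors n)))

-- Φ n is the n-th cyclotomic polynomial for n ≥ 1 (Φ 0 = 1 is a dummy value)
Φ : ℕ → Poly
Φ n = cycF n n

-- floor division (⌊ m / 0 ⌋ = 0 by convention; never used with 0 here)
⌊_/_⌋ : ℕ → ℕ → ℕ
⌊ m / zero ⌋  = 0
⌊ m / suc k ⌋ = m / suc k

Σ[0,<_] : ℕ → (ℕ → Poly) → Poly
Σ[0,< n ] f = polySum (map f (upTo n))

Σ[1,≤_] : ℕ → (ℕ → Poly) → Poly
Σ[1,≤ n ] f = polySum (map (λ j → f (suc j)) (upTo n))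

-- Write u = X − 1 and G n = 1 + X + ⋯ + X^(n−1), so that u · G n = X^n − 1, and let S be the double
-- sum.  Multiplying the i-th inner sum by X^q − 1 telescopes it to X^(pi) − X^(pi mod q).  As i runs
-- through 0, …, q−1 so does pi mod q, because p and q are coprime; hence
-- (X^q − 1) S + G q = H := Σ_{i<q} X^(pi).  Therefore
-- u · G q · G p · (1 + u S) = (X^p − 1) (G q + (X^q − 1) S) = (X^p − 1) H = X^(pq) − 1,
-- and 1 + u S is the quotient of X^(pq) − 1 by the product of Φ 1 = u, Φ q = G q and Φ p = G p.

module Submission where

-- `Φ` is the output of an algorithm on lists, so a factorisation of X^(pq) - 1 does not settle the
-- theorem: long division must be shown to return the cofactor, whatever trailing zeros the lists
-- carry. That is `divMonic-exact`. It rests on a multiplication of high-degree-first lists that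
-- long division undoes step by step, and on zero-stripped lists as canonical representatives,
-- through which division respects coefficientwise equality. Identities are stated without
-- subtraction: X - 1 is an atom `u` with u + 1 = X, and X^n - 1 enters as a polynomial that becomes
-- X^n after adding `one`. All rearrangements then take place in a commutative semiring, where the
-- solver applies, and the added `one` is cancelled at the end.

open import Algebra.Bundles using (CommutativeSemiring; CommutativeMonoid)
open import Algebra.Structures using (IsCommutativeMonoid)
open import Algebra.Structures.Biased using (isCommutativeMonoidˡ; isCommutativeSemiringˡ)
import Algebra.Solver.Ring.NaturalCoefficients.Default as SemiringSolver
open import Data.Integer as ℤ using (ℤ; +_; -[1+_]; 0ℤ; 1ℤ)
import Data.Integer.Properties as ℤ
open import Algebra.Properties.AbelianGroup ℤ.+-0-abelianGroup
  using () renaming (∙-cancelʳ to ℤ+-cancelʳ)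
open import Data.List
  using (List; []; _∷_; [_]; _++_; _∷ʳ_; replicate; reverse; length; map; upTo; downFrom; applyUpTo;
         foldr)
open import Data.List.Properties
open import Data.Nat as ℕ using (ℕ; zero; suc; _+_; _*_; _∸_; _>_; _≤_; _<_; _≤?_; z≤n; s≤s; NonZero)
import Data.Nat.Properties as ℕ
open import Data.List.Membership.Propositional using (_∈_)
open import Data.List.Membership.Propositional.Properties
  using (∈-∃++; ∈-upTo⁺; ∈-upTo⁻; ∈-downFrom⁺; ∈-applyUpTo⁻; ∈-filter⁺; ∈-filter⁻)
open import Data.List.Membership.Propositional.Properties.WithK using (unique∧set⇒bag)
open import Data.List.Relation.Binary.BagAndSetEquality using (∼bag⇒↭)
open import Data.List.Relation.Binary.Permutation.Propositional
  using (_↭_; ↭-refl; ↭-sym; ↭-trans; ↭-prep; ↭⇒↭ₛ)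
open import Data.List.Relation.Binary.Permutation.Propositional.Properties
  using (∈-resp-↭; ↭-length; shift)
open import Data.List.Relation.Binary.Permutation.Setoid.Properties using (foldr-commMonoid; map⁺)
open import Data.List.Relation.Unary.All as All using ([]; _∷_)
open import Data.List.Relation.Unary.AllPairs using ([]; _∷_)
open import Data.List.Relation.Unary.Any using (here; there)
open import Data.List.Relation.Unary.Unique.Propositional using (Unique)
open import Data.List.Relation.Unary.Unique.Propositional.Properties using (applyUpTo⁺₁; upTo⁺; filter⁺)
open import Data.Nat.Coprimality as Coprimality using (Coprime; coprime-divisor; prime⇒coprime)
open import Data.Nat.Divisibility
  using (_∣_; _∣?_; divides; divides-refl; ∣⇒≤; 1∣_; n∣m*n; m∣m*n; *-cancelʳ-∣)
open import Data.Nat.DivMod using (_/_; _%_; m≡m%n+[m/n]*n; m%n≡m∸m/n*n; m%n<n; m/n*n≤m)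
open import Data.Nat.Primality using (Prime; prime; prime⇒irreducible; prime⇒nonZero)
open import Data.Product using (∃; _×_; _,_)
open import Data.Sum using (_⊎_; inj₁; inj₂)
open import Function using (_∘_)
open import Function.Bundles using (mk⇔)
open import Level using (0ℓ)
open import Relation.Binary.Bundles using (Setoid)
open import Relation.Binary.Structures using (IsEquivalence)
import Relation.Binary.Reasoning.Setoid as SetoidReasoning
open import Relation.Binary.PropositionalEquality
  using (_≡_; _≢_; refl; sym; trans; cong; cong₂; subst; setoid; module ≡-Reasoning)
open import Relation.Nullary using (¬_; yes; no; contradiction)
open import Defs

-- The commutative semiring of polynomials

-- A record around _≈ₚ_, so that the two polynomials can be inferred from a proof.
infix 4 _≋_
record _≋_ (p q : Poly) : Set where
  constructor coeffwise
  field at : p ≈ₚ q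
open _≋_

≋-isEquivalence : IsEquivalence _≋_
≋-isEquivalence = record
  { refl  = coeffwise λ _ → refl
  ; sym   = λ e → coeffwise λ k → sym (at e k)
  ; trans = λ e f → coeffwise λ k → trans (at e k) (at f k)
  }

≋-setoid : Setoid 0ℓ 0ℓ
≋-setoid = record { isEquivalence = ≋-isEquivalence }

open IsEquivalence ≋-isEquivalence
  renaming (refl to ≋-refl; sym to ≋-sym; trans to ≋-trans; reflexive to ≋-reflexive)
module ≋-Reasoning = SetoidReasoning ≋-setoid

coeff-⊕ : ∀ p q k → coeff (p ⊕ q) k ≡ coeff p k ℤ.+ coeff q k
coeff-⊕ []      q       k       = sym (ℤ.+-identityˡ _)
coeff-⊕ (a ∷ p) []      k       = sym (ℤ.+-identityʳ _)
coeff-⊕ (a ∷ p) (b ∷ q) zero    = refl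
coeff-⊕ (a ∷ p) (b ∷ q) (suc k) = coeff-⊕ p q k

coeff-scale : ∀ c p k → coeff (scale c p) k ≡ c ℤ.* coeff p k
coeff-scale c []      k       = sym (ℤ.*-zeroʳ c)
coeff-scale c (a ∷ p) zero    = refl
coeff-scale c (a ∷ p) (suc k) = coeff-scale c p k

⊕-cong : ∀ {p p′ q q′} → p ≋ p′ → q ≋ q′ → p ⊕ q ≋ p′ ⊕ q′
⊕-cong {p} {p′} {q} {q′} e f = coeffwise λ k →
  trans (coeff-⊕ p q k) (trans (cong₂ ℤ._+_ (at e k) (at f k)) (sym (coeff-⊕ p′ q′ k)))

⊕-assoc : ∀ p q r → (p ⊕ q) ⊕ r ≋ p ⊕ (q ⊕ r)
⊕-assoc p q r = coeffwise λ k → begin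
  coeff ((p ⊕ q) ⊕ r) k                   ≡⟨ coeff-⊕ (p ⊕ q) r k ⟩
  coeff (p ⊕ q) k ℤ.+ coeff r k           ≡⟨ cong (ℤ._+ coeff r k) (coeff-⊕ p q k) ⟩
  coeff p k ℤ.+ coeff q k ℤ.+ coeff r k   ≡⟨ ℤ.+-assoc (coeff p k) _ _ ⟩
  coeff p k ℤ.+ (coeff q k ℤ.+ coeff r k) ≡⟨ cong (λ x → coeff p k ℤ.+ x) (coeff-⊕ q r k) ⟨
  coeff p k ℤ.+ coeff (q ⊕ r) k           ≡⟨ coeff-⊕ p (q ⊕ r) k ⟨
  coeff (p ⊕ (q ⊕ r)) k                   ∎
  where open ≡-Reasoning

⊕-comm : ∀ p q → p ⊕ q ≋ q ⊕ p
⊕-comm p q = coeffwise λ k →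
  trans (coeff-⊕ p q k) (trans (ℤ.+-comm (coeff p k) _) (sym (coeff-⊕ q p k)))

⊕-cancelʳ : ∀ r {p q} → p ⊕ r ≋ q ⊕ r → p ≋ q
⊕-cancelʳ r {p} {q} e = coeffwise λ k → ℤ+-cancelʳ (coeff r k) (coeff p k) (coeff q k)
  (trans (sym (coeff-⊕ p r k)) (trans (at e k) (coeff-⊕ q r k)))

⊕-isCommutativeMonoid : IsCommutativeMonoid _≋_ _⊕_ []
⊕-isCommutativeMonoid = isCommutativeMonoidˡ record
  { isSemigroup = record
    { isMagma = record { isEquivalence = ≋-isEquivalence ; ∙-cong = ⊕-cong }
    ; assoc   = ⊕-assoc
    }
  ; identityˡ = λ _ → ≋-refl
  ; comm      = ⊕-comm
  }

⊕-commutativeMonoid : CommutativeMonoid 0ℓ 0ℓ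
⊕-commutativeMonoid = record { isCommutativeMonoid = ⊕-isCommutativeMonoid }

open CommutativeMonoid ⊕-commutativeMonoid using ()
  renaming (identityʳ to ⊕-identityʳ)
open import Algebra.Properties.CommutativeSemigroup
  (CommutativeMonoid.commutativeSemigroup ⊕-commutativeMonoid)
  using () renaming (interchange to ⊕-interchange; x∙yz≈y∙xz to x⊕yz≋y⊕xz)

⊕-congˡ : ∀ p {q q′} → q ≋ q′ → p ⊕ q ≋ p ⊕ q′
⊕-congˡ p = ⊕-cong (≋-refl {p})

⊕-congʳ : ∀ r {p p′} → p ≋ p′ → p ⊕ r ≋ p′ ⊕ r
⊕-congʳ r e = ⊕-cong e (≋-refl {r})

∷-cong : ∀ {a b p q} → a ≡ b → p ≋ q → a ∷ p ≋ b ∷ q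
∷-cong a≡b e = coeffwise λ { zero → a≡b ; (suc k) → at e k }

0∷[]≋[] : 0ℤ ∷ [] ≋ []
0∷[]≋[] = coeffwise λ { zero → refl ; (suc k) → refl }

scale-cong : ∀ c {p q} → p ≋ q → scale c p ≋ scale c q
scale-cong c {p} {q} e = coeffwise λ k →
  trans (coeff-scale c p k) (trans (cong (c ℤ.*_) (at e k)) (sym (coeff-scale c q k)))

scale-⊕ : ∀ c p q → scale c (p ⊕ q) ≋ scale c p ⊕ scale c q
scale-⊕ c p q = coeffwise λ k → begin
  coeff (scale c (p ⊕ q)) k                       ≡⟨ coeff-scale c (p ⊕ q) k ⟩
  c ℤ.* coeff (p ⊕ q) k                           ≡⟨ cong (c ℤ.*_) (coeff-⊕ p q k) ⟩
  c ℤ.* (coeff p k ℤ.+ coeff q k)                 ≡⟨ ℤ.*-distribˡ-+ c (coeff p k) _ ⟩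
  c ℤ.* coeff p k ℤ.+ c ℤ.* coeff q k
    ≡⟨ cong₂ ℤ._+_ (coeff-scale c p k) (coeff-scale c q k) ⟨
  coeff (scale c p) k ℤ.+ coeff (scale c q) k     ≡⟨ coeff-⊕ (scale c p) (scale c q) k ⟨
  coeff (scale c p ⊕ scale c q) k                 ∎
  where open ≡-Reasoning

scale-+ : ∀ c d p → scale (c ℤ.+ d) p ≋ scale c p ⊕ scale d p
scale-+ c d p = coeffwise λ k → begin
  coeff (scale (c ℤ.+ d) p) k                     ≡⟨ coeff-scale (c ℤ.+ d) p k ⟩
  (c ℤ.+ d) ℤ.* coeff p k                         ≡⟨ ℤ.*-distribʳ-+ (coeff p k) c d ⟩
  c ℤ.* coeff p k ℤ.+ d ℤ.* coeff p k
    ≡⟨ cong₂ ℤ._+_ (coeff-scale c p k) (coeff-scale d p k) ⟨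
  coeff (scale c p) k ℤ.+ coeff (scale d p) k     ≡⟨ coeff-⊕ (scale c p) (scale d p) k ⟨
  coeff (scale c p ⊕ scale d p) k                 ∎
  where open ≡-Reasoning

scale-* : ∀ c d p → scale (c ℤ.* d) p ≋ scale c (scale d p)
scale-* c d p = coeffwise λ k → begin
  coeff (scale (c ℤ.* d) p) k   ≡⟨ coeff-scale (c ℤ.* d) p k ⟩
  c ℤ.* d ℤ.* coeff p k         ≡⟨ ℤ.*-assoc c d _ ⟩
  c ℤ.* (d ℤ.* coeff p k)       ≡⟨ cong (c ℤ.*_) (coeff-scale d p k) ⟨
  c ℤ.* coeff (scale d p) k     ≡⟨ coeff-scale c (scale d p) k ⟨
  coeff (scale c (scale d p)) k ∎
  where open ≡-Reasoning

scale-0 : ∀ p → scale 0ℤ p ≋ []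
scale-0 p = coeffwise (coeff-scale 0ℤ p)

scale-1 : ∀ p → scale 1ℤ p ≋ p
scale-1 p = coeffwise λ k → trans (coeff-scale 1ℤ p k) (ℤ.*-identityˡ _)

0∷-⊛ : ∀ p q → (0ℤ ∷ p) ⊛ q ≋ 0ℤ ∷ (p ⊛ q)
0∷-⊛ p q = ⊕-congʳ (0ℤ ∷ p ⊛ q) (scale-0 q)

⊛-zeroʳ : ∀ p → p ⊛ [] ≋ []
⊛-zeroʳ []      = ≋-refl
⊛-zeroʳ (a ∷ p) = ≋-trans (∷-cong refl (⊛-zeroʳ p)) 0∷[]≋[]

-- `⊛` recurses on its left factor; this is the matching recursion on the right factor, which turns
-- commutativity into an induction on one list.
⊛-∷ʳ : ∀ p b q → p ⊛ (b ∷ q) ≋ scale b p ⊕ (0ℤ ∷ (p ⊛ q))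
⊛-∷ʳ []      b q = ≋-sym 0∷[]≋[]
⊛-∷ʳ (a ∷ p) b q = ∷-cong (cong (ℤ._+ 0ℤ) (ℤ.*-comm a b)) (begin
  scale a q ⊕ p ⊛ (b ∷ q)                     ≈⟨ ⊕-congˡ (scale a q) (⊛-∷ʳ p b q) ⟩
  scale a q ⊕ (scale b p ⊕ (0ℤ ∷ (p ⊛ q)))    ≈⟨ x⊕yz≋y⊕xz (scale a q) (scale b p) _ ⟩
  scale b p ⊕ (scale a q ⊕ (0ℤ ∷ (p ⊛ q)))    ∎)
  where open ≋-Reasoning

⊛-comm : ∀ p q → p ⊛ q ≋ q ⊛ p
⊛-comm []      q = ≋-sym (⊛-zeroʳ q)
⊛-comm (a ∷ p) q = ≋-trans (⊕-congˡ (scale a q) (∷-cong refl (⊛-comm p q))) (≋-sym (⊛-∷ʳ q a p))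

⊛-congˡ : ∀ p {q q′} → q ≋ q′ → p ⊛ q ≋ p ⊛ q′
⊛-congˡ []      e = ≋-refl
⊛-congˡ (a ∷ p) e = ⊕-cong (scale-cong a e) (∷-cong refl (⊛-congˡ p e))

-- Equal polynomials may be lists of different lengths, so the two left factors cannot simply be
-- traversed in parallel; commutativity moves each change to the right factor.
⊛-cong : ∀ {p p′ q q′} → p ≋ p′ → q ≋ q′ → p ⊛ q ≋ p′ ⊛ q′
⊛-cong {p} {p′} {q} {q′} e f = begin
  p ⊛ q    ≈⟨ ⊛-congˡ p f ⟩
  p ⊛ q′   ≈⟨ ⊛-comm p q′ ⟩
  q′ ⊛ p   ≈⟨ ⊛-congˡ q′ e ⟩
  q′ ⊛ p′  ≈⟨ ⊛-comm q′ p′ ⟩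
  p′ ⊛ q′  ∎
  where open ≋-Reasoning

⊛-congʳ : ∀ r {p p′} → p ≋ p′ → p ⊛ r ≋ p′ ⊛ r
⊛-congʳ r e = ⊛-cong e (≋-refl {r})

⊛-distribʳ-⊕ : ∀ r p q → (p ⊕ q) ⊛ r ≋ p ⊛ r ⊕ q ⊛ r
⊛-distribʳ-⊕ r []      q       = ≋-refl
⊛-distribʳ-⊕ r (a ∷ p) []      = ≋-sym (⊕-identityʳ _)
⊛-distribʳ-⊕ r (a ∷ p) (b ∷ q) = begin
  scale (a ℤ.+ b) r ⊕ (0ℤ ∷ (p ⊕ q) ⊛ r)
    ≈⟨ ⊕-cong (scale-+ a b r) (∷-cong refl (⊛-distribʳ-⊕ r p q)) ⟩
  (scale a r ⊕ scale b r) ⊕ ((0ℤ ∷ p ⊛ r) ⊕ (0ℤ ∷ q ⊛ r))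
    ≈⟨ ⊕-interchange (scale a r) (scale b r) _ _ ⟩
  (scale a r ⊕ (0ℤ ∷ p ⊛ r)) ⊕ (scale b r ⊕ (0ℤ ∷ q ⊛ r))           ∎
  where open ≋-Reasoning

scale-⊛ : ∀ c p q → scale c p ⊛ q ≋ scale c (p ⊛ q)
scale-⊛ c []      q = ≋-refl
scale-⊛ c (a ∷ p) q = begin
  scale (c ℤ.* a) q ⊕ (0ℤ ∷ scale c p ⊛ q)
    ≈⟨ ⊕-cong (scale-* c a q) (∷-cong (sym (ℤ.*-zeroʳ c)) (scale-⊛ c p q)) ⟩
  scale c (scale a q) ⊕ scale c (0ℤ ∷ p ⊛ q)           ≈⟨ scale-⊕ c (scale a q) _ ⟨
  scale c (scale a q ⊕ (0ℤ ∷ p ⊛ q))                   ∎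
  where open ≋-Reasoning

⊛-assoc : ∀ p q r → (p ⊛ q) ⊛ r ≋ p ⊛ (q ⊛ r)
⊛-assoc []      q r = ≋-refl
⊛-assoc (a ∷ p) q r = begin
  (scale a q ⊕ (0ℤ ∷ p ⊛ q)) ⊛ r              ≈⟨ ⊛-distribʳ-⊕ r (scale a q) _ ⟩
  scale a q ⊛ r ⊕ (0ℤ ∷ p ⊛ q) ⊛ r            ≈⟨ ⊕-cong (scale-⊛ a q r) (0∷-⊛ (p ⊛ q) r) ⟩
  scale a (q ⊛ r) ⊕ (0ℤ ∷ (p ⊛ q) ⊛ r)
    ≈⟨ ⊕-congˡ (scale a (q ⊛ r)) (∷-cong refl (⊛-assoc p q r)) ⟩
  scale a (q ⊛ r) ⊕ (0ℤ ∷ p ⊛ (q ⊛ r))        ∎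
  where open ≋-Reasoning

C-⊛ : ∀ c p → C c ⊛ p ≋ scale c p
C-⊛ c p = ≋-trans (⊕-congˡ (scale c p) 0∷[]≋[]) (⊕-identityʳ _)

⊛-isCommutativeMonoid : IsCommutativeMonoid _≋_ _⊛_ one
⊛-isCommutativeMonoid = isCommutativeMonoidˡ record
  { isSemigroup = record
    { isMagma = record { isEquivalence = ≋-isEquivalence ; ∙-cong = ⊛-cong }
    ; assoc   = ⊛-assoc
    }
  ; identityˡ = λ p → ≋-trans (C-⊛ 1ℤ p) (scale-1 p)
  ; comm      = ⊛-comm
  }

polySemiring : CommutativeSemiring 0ℓ 0ℓ
polySemiring = record
  { isCommutativeSemiring = isCommutativeSemiringˡ record
    { +-isCommutativeMonoid = ⊕-isCommutativeMonoid
    ; *-isCommutativeMonoid = ⊛-isCommutativeMonoid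
    ; distribʳ              = ⊛-distribʳ-⊕
    ; zeroˡ                 = λ _ → ≋-refl
    }
  }

open CommutativeSemiring polySemiring using ()
  renaming (*-identityˡ to ⊛-identityˡ; *-identityʳ to ⊛-identityʳ)
module Solver = SemiringSolver polySemiring

X^-+ : ∀ m n → X^ (m + n) ≋ X^ m ⊛ X^ n
X^-+ zero    n = ≋-sym (⊛-identityˡ (X^ n))
X^-+ (suc m) n = ≋-trans (∷-cong refl (X^-+ m n)) (≋-sym (0∷-⊛ (X^ m) (X^ n)))

⊖-⊕ : ∀ p q → (p ⊖ q) ⊕ q ≋ p
⊖-⊕ p q = begin
  (p ⊕ scale (ℤ.- 1ℤ) q) ⊕ q     ≈⟨ ⊕-assoc p _ q ⟩
  p ⊕ (scale (ℤ.- 1ℤ) q ⊕ q)     ≈⟨ ⊕-congˡ p (⊕-congˡ (scale (ℤ.- 1ℤ) q) (scale-1 q)) ⟨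
  p ⊕ (scale (ℤ.- 1ℤ) q ⊕ scale 1ℤ q) ≈⟨ ⊕-congˡ p (scale-+ (ℤ.- 1ℤ) 1ℤ q) ⟨
  p ⊕ scale 0ℤ q                 ≈⟨ ⊕-congˡ p (scale-0 q) ⟩
  p ⊕ []                         ≈⟨ ⊕-identityʳ p ⟩
  p                              ∎
  where open ≋-Reasoning

-- Long division

-- Defs keeps its division loop, its subtraction step, dropZeros and the recursion behind Φ
-- private.  The unifier solves each underscore below by one of them, with quot₁ and subtract₁ their
-- specialisations to the leading coefficient 1.  Abstracting over the function reverse turns it into
-- a variable, which the unifier can treat as injective.

mutual
  cyc : ℕ → ℕ → Poly
  cyc = _

  Φ-suc : ∀ m → Φ (suc m) ≡ divMonic (X^ (suc m) ⊖ one) (polyProd (map (cyc m) (properDivisors (suc m))))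
  Φ-suc m = refl

mutual
  quot₁ : ℕ → List ℤ → List ℤ → List ℤ
  quot₁ = _

  divMonic-quot₁ : ∀ a b bt l → reverse b ≡ 1ℤ ∷ bt → reverse a ≡ 1ℤ ∷ l →
                   divMonic a b ≡ reverse (quot₁ (length a) bt l)
  divMonic-quot₁ a b bt l b≡ a≡ with reverse b | b≡
  ... | _ | refl with reverse a | a≡
  ... | _ | refl with length a | reverse {A = ℤ}
  ... | n | rev = refl {x = rev (quot₁ n bt l)}

mutual
  subtract₁ : List ℤ → List ℤ → List ℤ
  subtract₁ = _

  -- The last hypothesis makes the next dividend start with 1 again, so the recursive call is an
  -- instance of `quot₁` and the subtraction is the only unknown left.
  quot₁-step : ∀ n b bt r l → length (b ∷ bt) ≤ length (r ∷ l) → 1ℤ ≡ r ℤ.- 1ℤ ℤ.* b →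
               quot₁ (suc n) (b ∷ bt) (r ∷ l) ≡ 1ℤ ∷ quot₁ n (b ∷ bt) (subtract₁ bt l)
  quot₁-step n b bt r l bt≤l 1≡ with length (b ∷ bt) ≤? length (r ∷ l)
  ... | no bt≰l = contradiction bt≤l bt≰l
  ... | yes _ with r ℤ.- 1ℤ ℤ.* b | 1≡
  ... | _ | refl = refl

mutual
  quot : ℕ → List ℤ → List ℤ → List ℤ
  quot = _

  -- Naming the remainder `m` leaves a recursive call on variables only, from which the unifier can
  -- read off `quot`.
  quot₁-quot : ∀ n bt l m → length bt ≤ length l → subtract₁ bt l ≡ m →
               quot₁ (suc n) bt l ≡ 1ℤ ∷ quot n bt m
  quot₁-quot n bt l m bt≤l ≡m with length bt ≤? length l
  ... | no bt≰l = contradiction bt≤l bt≰l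
  ... | yes _ with subtract₁ bt l | ≡m
  ... | _ | refl = refl

mutual
  subtract : ℤ → List ℤ → List ℤ → List ℤ
  subtract = _

  quot-step : ∀ n bt x l → length bt ≤ length l → quot (suc n) bt (x ∷ l) ≡ x ∷ quot n bt (subtract x bt l)
  quot-step n bt x l bt≤l with length bt ≤? length l
  ... | no bt≰l = contradiction bt≤l bt≰l
  ... | yes _   = refl

quot-stop : ∀ n bt x l → ¬ (length bt ≤ length l) → quot (suc n) bt (x ∷ l) ≡ []
quot-stop n bt x l bt≰l with length bt ≤? length l
... | no _     = refl
... | yes bt≤l = contradiction bt≤l bt≰l

mutual
  strip : List ℤ → List ℤ
  strip = _

  divMonic-reverse : ∀ a b bt → reverse b ≡ 1ℤ ∷ bt →
                     divMonic a b ≡ reverse (quot (length a) bt (strip (reverse a)))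
  divMonic-reverse a b bt b≡ with reverse b | b≡
  ... | _ | refl with reverse a
  ... | l with length a | reverse {A = ℤ}
  ... | n | rev = refl {x = rev (quot n bt (strip l))}

-- Admits divisors with trailing zeros; this is the form in which division is used below.
divMonic-strip : ∀ a b bt → strip (reverse b) ≡ 1ℤ ∷ bt →
                 divMonic a b ≡ reverse (quot (length a) bt (strip (reverse a)))
divMonic-strip a b bt b≡ with strip (reverse b) | b≡
... | _ | refl = refl

-- Follows the clauses of the private subtraction with the sign changed, truncation included, so
-- that subtraction undoes it without any condition on lengths.
addMultiple : ℤ → List ℤ → List ℤ → List ℤ
addMultiple x []       l       = l
addMultiple x (_ ∷ _)  []      = []
addMultiple x (b ∷ bt) (r ∷ l) = (r ℤ.+ x ℤ.* b) ∷ addMultiple x bt l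

length-addMultiple : ∀ x bt l → length (addMultiple x bt l) ≡ length l
length-addMultiple x []       l       = refl
length-addMultiple x (_ ∷ _)  []      = refl
length-addMultiple x (b ∷ bt) (r ∷ l) = cong suc (length-addMultiple x bt l)

subtract-addMultiple : ∀ x bt l → subtract x bt (addMultiple x bt l) ≡ l
subtract-addMultiple x []       l       = refl
subtract-addMultiple x (_ ∷ _)  []      = refl
subtract-addMultiple x (b ∷ bt) (r ∷ l) = cong₂ _∷_ r+xb-xb≡r (subtract-addMultiple x bt l)
  where
  open ≡-Reasoning
  r+xb-xb≡r : (r ℤ.+ x ℤ.* b) ℤ.- x ℤ.* b ≡ r
  r+xb-xb≡r = begin
    (r ℤ.+ x ℤ.* b) ℤ.- x ℤ.* b    ≡⟨ ℤ.+-assoc r _ _ ⟩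
    r ℤ.+ (x ℤ.* b ℤ.- x ℤ.* b)    ≡⟨ cong (λ y → r ℤ.+ y) (ℤ.+-inverseʳ (x ℤ.* b)) ⟩
    r ℤ.+ 0ℤ                       ≡⟨ ℤ.+-identityʳ r ⟩
    r                              ∎

-- The product of c and 1 ∷ bt, all lists with the highest degree first.
monicMul : List ℤ → List ℤ → List ℤ
monicMul bt []      = replicate (length bt) 0ℤ
monicMul bt (x ∷ c) = x ∷ addMultiple x bt (monicMul bt c)

length-monicMul : ∀ bt c → length (monicMul bt c) ≡ length c + length bt
length-monicMul bt []      = length-replicate (length bt)
length-monicMul bt (x ∷ c) = cong suc (trans (length-addMultiple x bt _) (length-monicMul bt c))

-- `monicMul` is long division run backwards: each division step emits the head `x` and subtracts
-- exactly the multiple of `bt` that was added. What finally remains is as many zeros as `bt` has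
-- entries, too short for another step.
quot-monicMul : ∀ n bt c → length c ≤ n → quot n bt (monicMul bt c) ≡ c
quot-monicMul zero    bt       []      _ = refl
quot-monicMul (suc n) []       []      _ = refl
quot-monicMul (suc n) (b ∷ bt) []      _ = quot-stop n (b ∷ bt) 0ℤ (replicate (length bt) 0ℤ)
  (ℕ.<⇒≱ (s≤s (ℕ.≤-reflexive (length-replicate (length bt)))))
quot-monicMul (suc n) bt       (x ∷ c) (s≤s c≤n) = begin
  quot (suc n) bt (x ∷ addMultiple x bt (monicMul bt c))         ≡⟨ quot-step n bt x _ bt≤ ⟩
  x ∷ quot n bt (subtract x bt (addMultiple x bt (monicMul bt c)))
    ≡⟨ cong (λ l → x ∷ quot n bt l) (subtract-addMultiple x bt _) ⟩
  x ∷ quot n bt (monicMul bt c)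
    ≡⟨ cong (x ∷_) (quot-monicMul n bt c c≤n) ⟩
  x ∷ c                                                          ∎
  where
  open ≡-Reasoning
  bt≤ : length bt ≤ length (addMultiple x bt (monicMul bt c))
  bt≤ = subst (length bt ≤_) (sym (trans (length-addMultiple x bt _) (length-monicMul bt c)))
          (ℕ.m≤n+m (length bt) (length c))

∷ʳ-≋ : ∀ p x → p ∷ʳ x ≋ C x ⊛ X^ (length p) ⊕ p
∷ʳ-≋ []      x = ≋-sym (≋-trans (⊕-identityʳ _) (⊛-identityʳ (C x)))
∷ʳ-≋ (a ∷ p) x = begin
  a ∷ (p ∷ʳ x)                                  ≈⟨ ∷-cong (sym (ℤ.+-identityˡ a)) (∷ʳ-≋ p x) ⟩
  (0ℤ ∷ C x ⊛ X^ (length p)) ⊕ (a ∷ p)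
    ≈⟨ ⊕-congʳ (a ∷ p) (∷-cong (refl {x = 0ℤ}) (⊛-comm (C x) (X^ (length p)))) ⟩
  (0ℤ ∷ X^ (length p) ⊛ C x) ⊕ (a ∷ p)          ≈⟨ ⊕-congʳ (a ∷ p) (0∷-⊛ (X^ (length p)) (C x)) ⟨
  X^ (suc (length p)) ⊛ C x ⊕ (a ∷ p)
    ≈⟨ ⊕-congʳ (a ∷ p) (⊛-comm (X^ (suc (length p))) (C x)) ⟩
  C x ⊛ X^ (suc (length p)) ⊕ (a ∷ p)           ∎
  where open ≋-Reasoning

reverse-∷ : ∀ x l → reverse (x ∷ l) ≋ C x ⊛ X^ (length l) ⊕ reverse l
reverse-∷ x l = begin
  reverse (x ∷ l)                                     ≈⟨ ≋-reflexive (unfold-reverse x l) ⟩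
  reverse l ∷ʳ x                                      ≈⟨ ∷ʳ-≋ (reverse l) x ⟩
  C x ⊛ X^ (length (reverse l)) ⊕ reverse l
    ≈⟨ ≋-reflexive (cong (λ n → C x ⊛ X^ n ⊕ reverse l) (length-reverse l)) ⟩
  C x ⊛ X^ (length l) ⊕ reverse l                     ∎
  where open ≋-Reasoning

C-* : ∀ x y → C (x ℤ.* y) ≋ C x ⊛ C y
C-* x y = ≋-sym (C-⊛ x (C y))

-- The lists are aligned at their highest degrees, so the excess length `k` of `l` raises every
-- entry of `bt` by `k` degrees.
reverse-addMultiple : ∀ x bt l k → length l ≡ k + length bt →
  reverse (addMultiple x bt l) ≋ reverse l ⊕ C x ⊛ (X^ k ⊛ reverse bt)
reverse-addMultiple x []       l       k l≡ = begin
  reverse l                                 ≈⟨ ⊕-identityʳ _ ⟨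
  reverse l ⊕ []                            ≈⟨ ⊕-congˡ (reverse l) (⊛-zeroʳ (C x)) ⟨
  reverse l ⊕ C x ⊛ []                      ≈⟨ ⊕-congˡ (reverse l) (⊛-congˡ (C x) (⊛-zeroʳ (X^ k))) ⟨
  reverse l ⊕ C x ⊛ (X^ k ⊛ [])             ∎
  where open ≋-Reasoning
reverse-addMultiple x (b ∷ bt) []      k l≡ = contradiction (trans l≡ (ℕ.+-suc k _)) λ ()
reverse-addMultiple x (b ∷ bt) (r ∷ l) k l≡ = begin
  reverse ((r ℤ.+ x ℤ.* b) ∷ l′)
    ≈⟨ reverse-∷ _ l′ ⟩
  C (r ℤ.+ x ℤ.* b) ⊛ X^ (length l′) ⊕ reverse l′
    ≈⟨ ⊕-cong (⊛-cong C-+-* X^≋) (reverse-addMultiple x bt l k l≡′) ⟩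
  (C r ⊕ C x ⊛ C b) ⊛ (X^ k ⊛ X^ m) ⊕ (reverse l ⊕ C x ⊛ (X^ k ⊛ reverse bt))
    ≈⟨ rearrange ⟩
  (C r ⊛ (X^ k ⊛ X^ m) ⊕ reverse l) ⊕ C x ⊛ (X^ k ⊛ (C b ⊛ X^ m ⊕ reverse bt))
    ≈⟨ ⊕-cong (⊕-congʳ (reverse l) (⊛-congˡ (C r) X^l≋)) (⊛-congˡ (C x) (⊛-congˡ (X^ k) (reverse-∷ b bt))) ⟨
  (C r ⊛ X^ (length l) ⊕ reverse l) ⊕ C x ⊛ (X^ k ⊛ reverse (b ∷ bt))
    ≈⟨ ⊕-congʳ (C x ⊛ (X^ k ⊛ reverse (b ∷ bt))) (reverse-∷ r l) ⟨
  reverse (r ∷ l) ⊕ C x ⊛ (X^ k ⊛ reverse (b ∷ bt))                                         ∎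
  where
  open ≋-Reasoning
  l′ = addMultiple x bt l
  m  = length bt
  l≡′ : length l ≡ k + m
  l≡′ = ℕ.suc-injective (trans l≡ (ℕ.+-suc k m))
  X^l≋ : X^ (length l) ≋ X^ k ⊛ X^ m
  X^l≋ = ≋-trans (≋-reflexive (cong X^ l≡′)) (X^-+ k m)
  X^≋ : X^ (length l′) ≋ X^ k ⊛ X^ m
  X^≋ = ≋-trans (≋-reflexive (cong X^ (length-addMultiple x bt l))) X^l≋
  C-+-* : C (r ℤ.+ x ℤ.* b) ≋ C r ⊕ C x ⊛ C b
  C-+-* = ⊕-congˡ (C r) (C-* x b)
  rearrange : (C r ⊕ C x ⊛ C b) ⊛ (X^ k ⊛ X^ m) ⊕ (reverse l ⊕ C x ⊛ (X^ k ⊛ reverse bt)) ≋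
              (C r ⊛ (X^ k ⊛ X^ m) ⊕ reverse l) ⊕ C x ⊛ (X^ k ⊛ (C b ⊛ X^ m ⊕ reverse bt))
  rearrange = solve 7 (λ r x b k m l t →
      (r :+ x :* b) :* (k :* m) :+ (l :+ x :* (k :* t)) := (r :* (k :* m) :+ l) :+ x :* (k :* (b :* m :+ t)))
    ≋-refl (C r) (C x) (C b) (X^ k) (X^ m) (reverse l) (reverse bt)
    where open Solver

-- Expands (X^m + t)(x X^k + c): the new head gives x X^(k+m), `addMultiple` gives x X^k t, and the
-- induction hypothesis gives the rest.
reverse-monicMul : ∀ bt c → reverse (monicMul bt c) ≋ reverse (1ℤ ∷ bt) ⊛ reverse c
reverse-monicMul bt []      = ≋-trans (zeros (length bt)) (≋-sym (⊛-zeroʳ (reverse (1ℤ ∷ bt))))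
  where
  zeros : ∀ n → reverse (replicate n 0ℤ) ≋ []
  zeros zero    = ≋-refl
  zeros (suc n) = begin
    reverse (0ℤ ∷ replicate n 0ℤ)                             ≈⟨ reverse-∷ 0ℤ (replicate n 0ℤ) ⟩
    C 0ℤ ⊛ X^ (length (replicate n 0ℤ)) ⊕ reverse (replicate n 0ℤ)
      ≈⟨ ⊕-cong (⊛-congʳ (X^ (length (replicate n 0ℤ))) 0∷[]≋[]) (zeros n) ⟩
    []                                                        ∎
    where open ≋-Reasoning
reverse-monicMul bt (x ∷ c) = begin
  reverse (x ∷ addMultiple x bt l)
    ≈⟨ reverse-∷ x (addMultiple x bt l) ⟩
  C x ⊛ X^ (length (addMultiple x bt l)) ⊕ reverse (addMultiple x bt l)
    ≈⟨ ⊕-cong (⊛-congˡ (C x) X^≋) (reverse-addMultiple x bt l k (length-monicMul bt c)) ⟩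
  C x ⊛ (X^ k ⊛ X^ m) ⊕ (reverse l ⊕ C x ⊛ (X^ k ⊛ reverse bt))
    ≈⟨ ⊕-congˡ (C x ⊛ (X^ k ⊛ X^ m)) (⊕-congʳ (C x ⊛ (X^ k ⊛ reverse bt)) (reverse-monicMul bt c)) ⟩
  C x ⊛ (X^ k ⊛ X^ m) ⊕ (reverse (1ℤ ∷ bt) ⊛ reverse c ⊕ C x ⊛ (X^ k ⊛ reverse bt))
    ≈⟨ ⊕-congˡ (C x ⊛ (X^ k ⊛ X^ m)) (⊕-congʳ (C x ⊛ (X^ k ⊛ reverse bt)) (⊛-congʳ (reverse c) (reverse-∷ 1ℤ bt))) ⟩
  C x ⊛ (X^ k ⊛ X^ m) ⊕ ((one ⊛ X^ m ⊕ reverse bt) ⊛ reverse c ⊕ C x ⊛ (X^ k ⊛ reverse bt))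
    ≈⟨ rearrange ⟩
  (one ⊛ X^ m ⊕ reverse bt) ⊛ (C x ⊛ X^ k ⊕ reverse c)
    ≈⟨ ⊛-cong (reverse-∷ 1ℤ bt) (reverse-∷ x c) ⟨
  reverse (1ℤ ∷ bt) ⊛ reverse (x ∷ c)                                     ∎
  where
  open ≋-Reasoning
  l = monicMul bt c
  k = length c
  m = length bt
  X^≋ : X^ (length (addMultiple x bt l)) ≋ X^ k ⊛ X^ m
  X^≋ = ≋-trans (≋-reflexive (cong X^ (trans (length-addMultiple x bt l) (length-monicMul bt c)))) (X^-+ k m)
  rearrange : C x ⊛ (X^ k ⊛ X^ m) ⊕ ((one ⊛ X^ m ⊕ reverse bt) ⊛ reverse c ⊕ C x ⊛ (X^ k ⊛ reverse bt)) ≋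
              (one ⊛ X^ m ⊕ reverse bt) ⊛ (C x ⊛ X^ k ⊕ reverse c)
  rearrange = solve 5 (λ x k m t c →
      x :* (k :* m) :+ ((con 1 :* m :+ t) :* c :+ x :* (k :* t)) := (con 1 :* m :+ t) :* (x :* k :+ c))
    ≋-refl (C x) (X^ k) (X^ m) (reverse bt) (reverse c)
    where open Solver

-- Lists without trailing zeros are canonical representatives of polynomials.

infixr 5 _∷ᵗ_
_∷ᵗ_ : ℤ → Poly → Poly
+ 0 ∷ᵗ [] = []
a   ∷ᵗ p  = a ∷ p

trim : Poly → Poly
trim []      = []
trim (a ∷ p) = a ∷ᵗ trim p

∷ᵗ-≋ : ∀ a p → a ∷ᵗ p ≋ a ∷ p
∷ᵗ-≋ (+ 0)      []      = ≋-sym 0∷[]≋[]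
∷ᵗ-≋ (+ 0)      (_ ∷ _) = ≋-refl
∷ᵗ-≋ (+ suc _)  _       = ≋-refl
∷ᵗ-≋ (-[1+ _ ]) _       = ≋-refl

trim-≋ : ∀ p → trim p ≋ p
trim-≋ []      = ≋-refl
trim-≋ (a ∷ p) = ≋-trans (∷ᵗ-≋ a (trim p)) (∷-cong refl (trim-≋ p))

trim-cong : ∀ p q → p ≋ q → trim p ≡ trim q
trim-cong []      []      e = refl
trim-cong []      (b ∷ q) e
  rewrite sym (at e 0) | sym (trim-cong [] q (coeffwise λ k → at e (suc k))) = refl
trim-cong (a ∷ p) []      e
  rewrite at e 0 | trim-cong p [] (coeffwise λ k → at e (suc k)) = refl
trim-cong (a ∷ p) (b ∷ q) e =
  cong₂ _∷ᵗ_ (at e 0) (trim-cong p q (coeffwise λ k → at e (suc k)))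

∷ᵗ-∷ : ∀ a b p → a ∷ᵗ b ∷ p ≡ a ∷ b ∷ p
∷ᵗ-∷ (+ 0)      b p = refl
∷ᵗ-∷ (+ suc _)  b p = refl
∷ᵗ-∷ (-[1+ _ ]) b p = refl

∷ᵗ-∷ʳ : ∀ a p b → a ∷ᵗ (p ∷ʳ b) ≡ a ∷ (p ∷ʳ b)
∷ᵗ-∷ʳ a []      b = ∷ᵗ-∷ a b []
∷ᵗ-∷ʳ a (c ∷ p) b = ∷ᵗ-∷ a c (p ∷ʳ b)

reverse-∷ᵗ-reverse : ∀ a x l → reverse (a ∷ᵗ reverse (x ∷ l)) ≡ (x ∷ l) ∷ʳ a
reverse-∷ᵗ-reverse a x l = begin
  reverse (a ∷ᵗ reverse (x ∷ l))    ≡⟨ cong (λ p → reverse (a ∷ᵗ p)) (unfold-reverse x l) ⟩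
  reverse (a ∷ᵗ (reverse l ∷ʳ x))   ≡⟨ cong reverse (∷ᵗ-∷ʳ a (reverse l) x) ⟩
  reverse (a ∷ (reverse l ∷ʳ x))    ≡⟨ cong (λ p → reverse (a ∷ p)) (unfold-reverse x l) ⟨
  reverse (a ∷ reverse (x ∷ l))     ≡⟨ unfold-reverse a (reverse (x ∷ l)) ⟩
  reverse (reverse (x ∷ l)) ∷ʳ a    ≡⟨ cong (_∷ʳ a) (reverse-involutive (x ∷ l)) ⟩
  (x ∷ l) ∷ʳ a                      ∎
  where open ≡-Reasoning

-- A new lowest coefficient can be stripped only if everything above it was stripped, which is the
-- case that `_∷ᵗ_` singles out.
strip-∷ʳ : ∀ l a → strip (l ∷ʳ a) ≡ reverse (a ∷ᵗ reverse (strip l))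
strip-∷ʳ []                 (+ 0)      = refl
strip-∷ʳ []                 (+ suc _)  = refl
strip-∷ʳ []                 (-[1+ _ ]) = refl
strip-∷ʳ (+ 0 ∷ l)          a          = strip-∷ʳ l a
strip-∷ʳ (x@(+ suc _) ∷ l)  a          = sym (reverse-∷ᵗ-reverse a x l)
strip-∷ʳ (x@(-[1+ _ ]) ∷ l) a          = sym (reverse-∷ᵗ-reverse a x l)

strip-reverse : ∀ p → strip (reverse p) ≡ reverse (trim p)
strip-reverse []      = refl
strip-reverse (a ∷ p) = begin
  strip (reverse (a ∷ p))                    ≡⟨ cong strip (unfold-reverse a p) ⟩
  strip (reverse p ∷ʳ a)                     ≡⟨ strip-∷ʳ (reverse p) a ⟩
  reverse (a ∷ᵗ reverse (strip (reverse p)))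
    ≡⟨ cong (λ l → reverse (a ∷ᵗ reverse l)) (strip-reverse p) ⟩
  reverse (a ∷ᵗ reverse (reverse (trim p)))
    ≡⟨ cong (λ l → reverse (a ∷ᵗ l)) (reverse-involutive (trim p)) ⟩
  reverse (trim (a ∷ p))                     ∎
  where open ≡-Reasoning

-- Division looks at its arguments only after stripping, so it depends on the polynomials and not on
-- the lists; here either argument gets replaced by a convenient representative.
strip-cong : ∀ l m → reverse l ≋ reverse m → strip l ≡ strip m
strip-cong l m e = begin
  strip l                     ≡⟨ cong strip (reverse-involutive l) ⟨
  strip (reverse (reverse l)) ≡⟨ strip-reverse (reverse l) ⟩
  reverse (trim (reverse l))  ≡⟨ cong reverse (trim-cong (reverse l) (reverse m) e) ⟩
  reverse (trim (reverse m))  ≡⟨ strip-reverse (reverse m) ⟨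
  strip (reverse (reverse m)) ≡⟨ cong strip (reverse-involutive m) ⟩
  strip m                     ∎
  where open ≡-Reasoning

-- Exact division by monic polynomials

strip-replicate : ∀ n → strip (replicate n 0ℤ) ≡ []
strip-replicate zero    = refl
strip-replicate (suc n) = strip-replicate n

length-strip : ∀ l → length (strip l) ≤ length l
length-strip []               = z≤n
length-strip (+ 0 ∷ l)        = ℕ.m≤n⇒m≤1+n (length-strip l)
length-strip (+ suc _ ∷ l)    = ℕ.≤-refl
length-strip (-[1+ _ ] ∷ l)   = ℕ.≤-refl

quot-[] : ∀ n bt → quot n bt [] ≡ []
quot-[] zero    bt = refl
quot-[] (suc n) bt = refl

-- A nonzero quotient puts its leading coefficient at the head of the product, so stripping changes
-- nothing there; for the zero quotient the product consists of zeros and is stripped to the empty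
-- list.
quot-strip-monicMul : ∀ n bt c → length (strip (monicMul bt (strip c))) ≤ n →
                      quot n bt (strip (monicMul bt (strip c))) ≡ strip c
quot-strip-monicMul n bt []             _  = trans (cong (quot n bt) (strip-replicate (length bt))) (quot-[] n bt)
quot-strip-monicMul n bt (+ 0 ∷ c)      ≤n = quot-strip-monicMul n bt c ≤n
quot-strip-monicMul n bt c@(+ suc _ ∷ _)  ≤n = quot-monicMul n bt c
  (ℕ.≤-trans (ℕ.m≤m+n _ _) (subst (_≤ n) (length-monicMul bt c) ≤n))
quot-strip-monicMul n bt c@(-[1+ _ ] ∷ _) ≤n = quot-monicMul n bt c
  (ℕ.≤-trans (ℕ.m≤m+n _ _) (subst (_≤ n) (length-monicMul bt c) ≤n))

-- Phrased with the shape `1ℤ ∷ bt` on which `divMonic` branches, and up to `_≋_` so that trailing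
-- zeros do no harm.
Monic : Poly → Set
Monic p = ∃ λ bt → p ≋ reverse (1ℤ ∷ bt)

-- After stripping, `a` is indistinguishable from the `monicMul` product of the divisor and the
-- stripped quotient, and on such products division is already understood.
divMonic-exact : ∀ a b c → Monic b → a ≋ b ⊛ c → divMonic a b ≋ c
divMonic-exact a b c (bt , b≋) a≋ = begin
  divMonic a b
    ≈⟨ ≋-reflexive (divMonic-strip a b bt b-strip) ⟩
  reverse (quot (length a) bt (strip (reverse a)))
    ≈⟨ ≋-reflexive (cong (λ l → reverse (quot (length a) bt l)) a-strip) ⟩
  reverse (quot (length a) bt (strip (monicMul bt cr)))
    ≈⟨ ≋-reflexive (cong reverse (quot-strip-monicMul (length a) bt (reverse c) bound)) ⟩
  reverse cr                                              ≈⟨ reverse-cr ⟩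
  c                                                       ∎
  where
  open ≋-Reasoning
  cr = strip (reverse c)
  b-strip : strip (reverse b) ≡ 1ℤ ∷ bt
  b-strip = strip-cong (reverse b) (1ℤ ∷ bt) (≋-trans (≋-reflexive (reverse-involutive b)) b≋)
  reverse-cr : reverse cr ≋ c
  reverse-cr = begin
    reverse cr                 ≈⟨ ≋-reflexive (cong reverse (strip-reverse c)) ⟩
    reverse (reverse (trim c)) ≈⟨ ≋-reflexive (reverse-involutive (trim c)) ⟩
    trim c                     ≈⟨ trim-≋ c ⟩
    c                          ∎
  a-strip : strip (reverse a) ≡ strip (monicMul bt cr)
  a-strip = strip-cong (reverse a) (monicMul bt cr) (begin
    reverse (reverse a)              ≈⟨ ≋-reflexive (reverse-involutive a) ⟩
    a                                ≈⟨ a≋ ⟩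
    b ⊛ c                            ≈⟨ ⊛-cong b≋ (≋-sym reverse-cr) ⟩
    reverse (1ℤ ∷ bt) ⊛ reverse cr   ≈⟨ reverse-monicMul bt cr ⟨
    reverse (monicMul bt cr)         ∎)
  -- The fuel of `divMonic` is the unstripped length of `a`, hence at least the stripped length.
  bound : length (strip (monicMul bt cr)) ≤ length a
  bound = subst (_≤ length a) (cong length a-strip)
    (ℕ.≤-trans (length-strip (reverse a)) (ℕ.≤-reflexive (length-reverse a)))

Monic-⊛ : ∀ {p q} → Monic p → Monic q → Monic (p ⊛ q)
Monic-⊛ (bt , p≋) (ct , q≋) =
  addMultiple 1ℤ bt (monicMul bt ct) , ≋-trans (⊛-cong p≋ q≋) (≋-sym (reverse-monicMul bt (1ℤ ∷ ct)))

Monic-resp-≋ : ∀ {p q} → p ≋ q → Monic q → Monic p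
Monic-resp-≋ p≋q (bt , q≋) = bt , ≋-trans p≋q q≋

-- Sums of powers of X

sum-linear : ∀ w (f g h : ℕ → Poly) → (∀ i → w ⊛ f i ⊕ g i ≋ h i) → ∀ is →
             w ⊛ polySum (map f is) ⊕ polySum (map g is) ≋ polySum (map h is)
sum-linear w f g h step []       = ≋-trans (⊕-identityʳ _) (⊛-zeroʳ w)
sum-linear w f g h step (i ∷ is) = begin
  w ⊛ (f i ⊕ F) ⊕ (g i ⊕ G)        ≈⟨ rearrange ⟩
  (w ⊛ f i ⊕ g i) ⊕ (w ⊛ F ⊕ G)    ≈⟨ ⊕-cong (step i) (sum-linear w f g h step is) ⟩
  h i ⊕ polySum (map h is)         ∎
  where
  open ≋-Reasoning
  F = polySum (map f is)
  G = polySum (map g is)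
  rearrange : w ⊛ (f i ⊕ F) ⊕ (g i ⊕ G) ≋ (w ⊛ f i ⊕ g i) ⊕ (w ⊛ F ⊕ G)
  rearrange = solve 5 (λ w f F g G → w :* (f :+ F) :+ (g :+ G) := (w :* f :+ g) :+ (w :* F :+ G))
    ≋-refl w (f i) F (g i) G
    where open Solver

-- Taking a or b to be [] gives the increasing and the decreasing telescoping sum without subtraction.
telescope : ∀ a b (f g : ℕ → Poly) n → (∀ i → i < n → a ⊛ f i ⊕ g i ≋ b ⊛ f i ⊕ g (suc i)) →
            a ⊛ polySum (map f (upTo n)) ⊕ g 0 ≋ b ⊛ polySum (map f (upTo n)) ⊕ g n
telescope a b f g n step rewrite map-upTo f n = go f g n step
  where
  go : ∀ f g n → (∀ i → i < n → a ⊛ f i ⊕ g i ≋ b ⊛ f i ⊕ g (suc i)) →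
       a ⊛ polySum (applyUpTo f n) ⊕ g 0 ≋ b ⊛ polySum (applyUpTo f n) ⊕ g n
  go f g zero    step = ⊕-congʳ (g 0) (≋-trans (⊛-zeroʳ a) (≋-sym (⊛-zeroʳ b)))
  go f g (suc n) step = begin
    a ⊛ (f 0 ⊕ F) ⊕ g 0                   ≈⟨ rearrange₁ ⟩
    (a ⊛ f 0 ⊕ g 0) ⊕ a ⊛ F               ≈⟨ ⊕-congʳ (a ⊛ F) (step 0 (s≤s z≤n)) ⟩
    (b ⊛ f 0 ⊕ g 1) ⊕ a ⊛ F               ≈⟨ rearrange₂ ⟩
    b ⊛ f 0 ⊕ (a ⊛ F ⊕ g 1)
      ≈⟨ ⊕-congˡ (b ⊛ f 0) (go (f ∘ suc) (g ∘ suc) n (λ i i<n → step (suc i) (s≤s i<n))) ⟩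
    b ⊛ f 0 ⊕ (b ⊛ F ⊕ g (suc n))         ≈⟨ rearrange₃ ⟩
    b ⊛ (f 0 ⊕ F) ⊕ g (suc n)             ∎
    where
    open ≋-Reasoning
    open Solver
    F = polySum (applyUpTo (f ∘ suc) n)
    rearrange₁ : a ⊛ (f 0 ⊕ F) ⊕ g 0 ≋ (a ⊛ f 0 ⊕ g 0) ⊕ a ⊛ F
    rearrange₁ = solve 4 (λ a f F g → a :* (f :+ F) :+ g := (a :* f :+ g) :+ a :* F) ≋-refl a (f 0) F (g 0)
    rearrange₂ : (b ⊛ f 0 ⊕ g 1) ⊕ a ⊛ F ≋ b ⊛ f 0 ⊕ (a ⊛ F ⊕ g 1)
    rearrange₂ = solve 3 (λ x g y → (x :+ g) :+ y := x :+ (y :+ g)) ≋-refl (b ⊛ f 0) (g 1) (a ⊛ F)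
    rearrange₃ : b ⊛ f 0 ⊕ (b ⊛ F ⊕ g (suc n)) ≋ b ⊛ (f 0 ⊕ F) ⊕ g (suc n)
    rearrange₃ = solve 4 (λ b f F g → b :* f :+ (b :* F :+ g) := b :* (f :+ F) :+ g) ≋-refl b (f 0) F (g (suc n))

-- Counting down makes `geom (suc n)` compute to `X^ n ⊕ geom n`.
geom : ℕ → Poly
geom n = polySum (map X^ (downFrom n))

-- The step of every telescoping below: `w` plays X^m - 1 and is instantiated with `u`, `P` and `Q`.
⊛-X^ : ∀ w m k → w ⊕ one ≋ X^ m → w ⊛ X^ k ⊕ X^ k ≋ X^ (m + k)
⊛-X^ w m k w+1 = begin
  w ⊛ X^ k ⊕ X^ k        ≈⟨ ⊕-congˡ (w ⊛ X^ k) (⊛-identityˡ (X^ k)) ⟨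
  w ⊛ X^ k ⊕ one ⊛ X^ k  ≈⟨ ⊛-distribʳ-⊕ (X^ k) w one ⟨
  (w ⊕ one) ⊛ X^ k       ≈⟨ ⊛-congʳ (X^ k) w+1 ⟩
  X^ m ⊛ X^ k            ≈⟨ X^-+ m k ⟨
  X^ (m + k)             ∎
  where open ≋-Reasoning

geom-telescope : ∀ n → (X ⊖ one) ⊛ geom n ⊕ one ≋ X^ n
geom-telescope zero    = ⊕-congʳ one (⊛-zeroʳ (X ⊖ one))
geom-telescope (suc n) = begin
  u ⊛ (X^ n ⊕ geom n) ⊕ one           ≈⟨ rearrange ⟩
  u ⊛ X^ n ⊕ (u ⊛ geom n ⊕ one)       ≈⟨ ⊕-congˡ (u ⊛ X^ n) (geom-telescope n) ⟩
  u ⊛ X^ n ⊕ X^ n                     ≈⟨ ⊛-X^ u 1 n (⊖-⊕ X one) ⟩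
  X^ (suc n)                          ∎
  where
  open ≋-Reasoning
  u = X ⊖ one
  rearrange : u ⊛ (X^ n ⊕ geom n) ⊕ one ≋ u ⊛ X^ n ⊕ (u ⊛ geom n ⊕ one)
  rearrange = solve 4 (λ u x g o → u :* (x :+ g) :+ o := u :* x :+ (u :* g :+ o)) ≋-refl u (X^ n) (geom n) one
    where open Solver

Monic-one : Monic one
Monic-one = [] , ≋-refl

Monic-X⊖one : Monic (X ⊖ one)
Monic-X⊖one = ℤ.- 1ℤ ∷ [] , ≋-refl

Monic-geom : ∀ n → Monic (geom (suc n))
Monic-geom n = replicate n 1ℤ , geom≋ (suc n)
  where
  geom≋ : ∀ n → geom n ≋ reverse (replicate n 1ℤ)
  geom≋ zero    = ≋-refl
  geom≋ (suc n) = begin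
    X^ n ⊕ geom n
      ≈⟨ ⊕-cong (≋-sym (⊛-identityˡ (X^ n))) (geom≋ n) ⟩
    one ⊛ X^ n ⊕ reverse (replicate n 1ℤ)
      ≈⟨ ≋-reflexive (cong (λ k → one ⊛ X^ k ⊕ reverse (replicate n 1ℤ)) (length-replicate n)) ⟨
    one ⊛ X^ (length (replicate n 1ℤ)) ⊕ reverse (replicate n 1ℤ)
      ≈⟨ reverse-∷ 1ℤ (replicate n 1ℤ) ⟨
    reverse (replicate (suc n) 1ℤ)                                       ∎
    where open ≋-Reasoning

-- Residues and divisors

-- Pigeonhole: remove the head `x` from `ys`; the other entries of `xs` differ from `x`, so they
-- survive in what is left.
unique-⊆⇒↭ : ∀ {A : Set} {xs ys : List A} → Unique xs → (∀ {x} → x ∈ xs → x ∈ ys) →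
             length ys ≤ length xs → xs ↭ ys
unique-⊆⇒↭ {xs = []}     {[]} _              _     _  = ↭-refl
unique-⊆⇒↭ {xs = x ∷ xs} (x∉xs ∷ unique) xs⊆ys ≤xs with as , bs , refl ← ∈-∃++ (xs⊆ys (here refl)) =
  ↭-trans (↭-prep x (unique-⊆⇒↭ unique xs⊆ (ℕ.s≤s⁻¹ (subst (_≤ _) (↭-length (shift x as bs)) ≤xs))))
          (↭-sym (shift x as bs))
  where
  xs⊆ : ∀ {y} → y ∈ xs → y ∈ as ++ bs
  xs⊆ y∈xs with ∈-resp-↭ (shift x as bs) (xs⊆ys (there y∈xs))
  ... | here y≡x   = contradiction (sym y≡x) (All.lookup x∉xs y∈xs)
  ... | there y∈   = y∈

%≡⇒∣∸ : ∀ m n d .{{_ : NonZero d}} → m % d ≡ n % d → d ∣ m ∸ n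
%≡⇒∣∸ m n d m≡n = divides (m / d ∸ n / d) (begin
  m ∸ n
    ≡⟨ cong₂ _∸_ (m≡m%n+[m/n]*n m d) (m≡m%n+[m/n]*n n d) ⟩
  (m % d + m / d * d) ∸ (n % d + n / d * d)
    ≡⟨ cong (λ r → (r + m / d * d) ∸ (n % d + n / d * d)) m≡n ⟩
  (n % d + m / d * d) ∸ (n % d + n / d * d)          ≡⟨ ℕ.[m+n]∸[m+o]≡n∸o (n % d) _ _ ⟩
  m / d * d ∸ n / d * d                              ≡⟨ ℕ.*-distribʳ-∸ d (m / d) (n / d) ⟨
  (m / d ∸ n / d) * d                                ∎)
  where open ≡-Reasoning

-- By pigeonhole, injectivity is enough. If i < j < q give the same residue, then `q` divides p(j -
-- i), hence j - i by coprimality, although 0 < j - i < q.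
residues-↭ : ∀ p q .{{_ : NonZero q}} → Coprime q p → map (λ i → p * i % q) (upTo q) ↭ downFrom q
residues-↭ p q coprime rewrite map-upTo (λ i → p * i % q) q =
  unique-⊆⇒↭ (applyUpTo⁺₁ (λ i → p * i % q) q injective) residue∈
    (ℕ.≤-reflexive (trans (length-downFrom q) (sym (length-applyUpTo _ q))))
  where
  residue∈ : ∀ {r} → r ∈ applyUpTo (λ i → p * i % q) q → r ∈ downFrom q
  residue∈ r∈ with i , _ , refl ← ∈-applyUpTo⁻ (λ i → p * i % q) r∈ = ∈-downFrom⁺ (m%n<n (p * i) q)
  injective : ∀ {i j} → i < j → j < q → p * i % q ≢ p * j % q
  injective {i} {j} i<j j<q eq = ℕ.<⇒≱ (ℕ.≤-<-trans (ℕ.m∸n≤m j i) j<q) (∣⇒≤ {{ℕ.>-nonZero (ℕ.m<n⇒0<n∸m i<j)}} q∣j∸i)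
    where
    q∣j∸i : q ∣ j ∸ i
    q∣j∸i = coprime-divisor coprime (subst (q ∣_) (sym (ℕ.*-distribˡ-∸ p j i)) (%≡⇒∣∸ (p * j) (p * i) q (sym eq)))

-- The filter does not evaluate for a variable `n`. Two lists without repetitions and with the same
-- members agree up to order, which suffices because the list only feeds a product.
properDivisors-↭ : ∀ {n ds} → Unique ds → (∀ {d} → d ∈ ds → d < n × d ∣ n) →
                   (∀ {d} → d < n → d ∣ n → d ∈ ds) → properDivisors n ↭ ds
properDivisors-↭ {n} unique sound complete =
  ∼bag⇒↭ (unique∧set⇒bag (filter⁺ (_∣? n) (upTo⁺ n)) unique (mk⇔
    (λ d∈ → let d∈upTo , d∣n = ∈-filter⁻ (_∣? n) d∈ in complete (∈-upTo⁻ d∈upTo) d∣n)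
    (λ d∈ → let d<n , d∣n = sound d∈ in ∈-filter⁺ (_∣? n) (∈-upTo⁺ d<n) d∣n)))

prime>1 : ∀ {p} → Prime p → 1 < p
prime>1 (prime _) = ℕ.nonTrivial⇒n>1 _

properDivisors-prime : ∀ {p} → Prime p → properDivisors p ↭ [ 1 ]
properDivisors-prime {p} pp = properDivisors-↭ ([] ∷ [])
  (λ { (here refl) → prime>1 pp , 1∣ p })
  (λ d<p d∣p → case-⊎ d<p (prime⇒irreducible pp d∣p))
  where
  case-⊎ : ∀ {d} → d < p → d ≡ 1 ⊎ d ≡ p → d ∈ [ 1 ]
  case-⊎ d<p (inj₁ d≡1) = here d≡1
  case-⊎ d<p (inj₂ d≡p) = contradiction d≡p (ℕ.<⇒≢ d<p)

-- If d = eq, then `e` divides `p`, and e = p is excluded by d < pq. If `q` does not divide `d`,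
-- then `d` is coprime to `q` and so divides `p`.
properDivisors-prime*prime : ∀ {p q} → Prime p → Prime q → q < p → properDivisors (p * q) ↭ 1 ∷ q ∷ p ∷ []
properDivisors-prime*prime {p} {q} pp pq q<p = properDivisors-↭
  ((ℕ.<⇒≢ 1<q ∷ ℕ.<⇒≢ 1<p ∷ []) ∷ (ℕ.<⇒≢ q<p ∷ []) ∷ [] ∷ []) sound complete
  where
  instance
    _ = prime⇒nonZero pp
    _ = prime⇒nonZero pq
  1<p = prime>1 pp
  1<q = prime>1 pq
  p<pq : p < p * q
  p<pq = ℕ.m<m*n p q 1<q
  sound : ∀ {d} → d ∈ 1 ∷ q ∷ p ∷ [] → d < p * q × d ∣ p * q
  sound (here refl)                 = ℕ.<-trans 1<p p<pq , 1∣ (p * q)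
  sound (there (here refl))         = ℕ.<-trans q<p p<pq , n∣m*n p
  sound (there (there (here refl))) = p<pq , m∣m*n q
  complete : ∀ {d} → d < p * q → d ∣ p * q → d ∈ 1 ∷ q ∷ p ∷ []
  complete {d} d<pq d∣pq with q ∣? d
  ... | yes (divides-refl e) with prime⇒irreducible pp (*-cancelʳ-∣ {e} q d∣pq)
  ...   | inj₁ refl = there (here (ℕ.*-identityˡ q))
  ...   | inj₂ refl = contradiction d<pq (ℕ.<-irrefl refl)
  complete {d} d<pq d∣pq | no q∤d with prime⇒irreducible pp (coprime-divisor d⊥q (subst (d ∣_) (ℕ.*-comm p q) d∣pq))
    where
    d⊥q : Coprime d q
    d⊥q (e∣d , e∣q) with prime⇒irreducible pq e∣q
    ... | inj₁ e≡1 = e≡1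
    ... | inj₂ refl = contradiction e∣d q∤d
  ... | inj₁ d≡1 = here d≡1
  ... | inj₂ d≡p = there (there (here d≡p))

foldr-map-↭ : ∀ {_∙_ ε} → IsCommutativeMonoid _≋_ _∙_ ε → ∀ (f : ℕ → Poly) {is js} → is ↭ js →
              foldr _∙_ ε (map f is) ≋ foldr _∙_ ε (map f js)
foldr-map-↭ isCommutativeMonoid f is↭js =
  foldr-commMonoid ≋-setoid isCommutativeMonoid
    (map⁺ (setoid ℕ) ≋-setoid (λ i≡j → ≋-reflexive (cong f i≡j)) (↭⇒↭ₛ is↭js))

-- Cyclotomic polynomials

-- Two levels of fuel suffice: one for `p` and one for its only proper divisor 1, where the
-- recursion evaluates to `X ⊖ one` (division by the empty product).
cyc-prime : ∀ f {p} → Prime p → cyc (suc (suc f)) p ≋ geom p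
cyc-prime f {p} pp = divMonic-exact _ _ (geom p)
  (Monic-resp-≋ denominator Monic-X⊖one)
  (⊕-cancelʳ one (begin
    (X^ p ⊖ one) ⊕ one                ≈⟨ ⊖-⊕ (X^ p) one ⟩
    X^ p                              ≈⟨ geom-telescope p ⟨
    (X ⊖ one) ⊛ geom p ⊕ one          ≈⟨ ⊕-congʳ one (⊛-congʳ (geom p) denominator) ⟨
    polyProd (map (cyc (suc f)) (properDivisors p)) ⊛ geom p ⊕ one  ∎))
  where
  open ≋-Reasoning
  denominator : polyProd (map (cyc (suc f)) (properDivisors p)) ≋ X ⊖ one
  denominator = ≋-trans (foldr-map-↭ ⊛-isCommutativeMonoid (cyc (suc f)) (properDivisors-prime pp)) (⊛-identityʳ (X ⊖ one))

⌊/⌋≡/ : ∀ m n .{{_ : NonZero n}} → ⌊ m / n ⌋ ≡ m / n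
⌊/⌋≡/ m (suc n) = refl

-- The double sum for two primes

module _ (p q : ℕ) (pp : Prime p) (pq : Prime q) (q<p : q < p) where

  private
    instance
      p-nonZero : NonZero p
      p-nonZero = prime⇒nonZero pp
      q-nonZero : NonZero q
      q-nonZero = prime⇒nonZero pq
    u P Q H S : Poly
    u = X ⊖ one
    P = u ⊛ geom p
    Q = u ⊛ geom q
    H = Σ[0,< q ] (λ i → X^ (p * i))
    S = Σ[0,< q ] (λ i → Σ[1,≤ ⌊ p * i / q ⌋ ] (λ j → X^ (p * i ∸ q * j)))

  -- The exponents descend from `n` in steps of `q` and stop at n - q⌊n/q⌋, which is the remainder;
  -- the multiplier `[]` gives the descending form of `telescope`.
  inner-sum : ∀ n → Q ⊛ Σ[1,≤ ⌊ n / q ⌋ ] (λ j → X^ (n ∸ q * j)) ⊕ X^ (n % q) ≋ X^ n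
  inner-sum n rewrite ⌊/⌋≡/ n q {{q-nonZero}} = begin
    Q ⊛ T ⊕ X^ (n % q)                  ≈⟨ ≋-reflexive (cong (λ r → Q ⊛ T ⊕ X^ r) n%q≡) ⟩
    Q ⊛ T ⊕ X^ (n ∸ q * (n / q))
      ≈⟨ telescope [] Q (λ j → X^ (n ∸ q * suc j)) (λ j → X^ (n ∸ q * j)) (n / q) step ⟨
    X^ (n ∸ q * 0)                      ≈⟨ ≋-reflexive (cong (λ k → X^ (n ∸ k)) (ℕ.*-zeroʳ q)) ⟩
    X^ n                                ∎
    where
    open ≋-Reasoning
    T = Σ[1,≤ n / q ] (λ j → X^ (n ∸ q * j))
    n%q≡ : n % q ≡ n ∸ q * (n / q)
    n%q≡ = trans (m%n≡m∸m/n*n n q) (cong (n ∸_) (ℕ.*-comm (n / q) q))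
    -- The bound on `j` keeps q(j+1) within `n`, so the truncated subtraction is exact.
    exponent : ∀ j → j < n / q → n ∸ q * j ≡ q + (n ∸ q * suc j)
    exponent j j<n/q = E.begin
      n ∸ q * j               E.≡⟨ cong (_∸ q * j) (ℕ.m+[n∸m]≡n q[1+j]≤n) ⟨
      q * suc j + r ∸ q * j   E.≡⟨ cong (λ k → k + r ∸ q * j) (trans (ℕ.*-suc q j) (ℕ.+-comm q _)) ⟩
      q * j + q + r ∸ q * j   E.≡⟨ cong (_∸ q * j) (ℕ.+-assoc (q * j) q r) ⟩
      q * j + (q + r) ∸ q * j E.≡⟨ ℕ.m+n∸m≡n (q * j) _ ⟩
      q + r                   E.∎
      where
      module E = ≡-Reasoning
      r = n ∸ q * suc j
      q[1+j]≤n : q * suc j ≤ n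
      q[1+j]≤n = ℕ.≤-trans (ℕ.*-monoʳ-≤ q j<n/q) (subst (_≤ n) (ℕ.*-comm (n / q) q) (m/n*n≤m n q))
    step : ∀ j → j < n / q → X^ (n ∸ q * j) ≋ Q ⊛ X^ (n ∸ q * suc j) ⊕ X^ (n ∸ q * suc j)
    step j j<n/q = ≋-trans (≋-reflexive (cong X^ (exponent j j<n/q)))
      (≋-sym (⊛-X^ Q q (n ∸ q * suc j) (geom-telescope q)))

  double-sum : Q ⊛ S ⊕ geom q ≋ H
  double-sum = begin
    Q ⊛ S ⊕ geom q
      ≈⟨ ⊕-congˡ (Q ⊛ S) (foldr-map-↭ ⊕-isCommutativeMonoid X^ (residues-↭ p q (Coprimality.sym (prime⇒coprime pp q<p)))) ⟨
    Q ⊛ S ⊕ polySum (map X^ (map (λ i → p * i % q) (upTo q)))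
      ≈⟨ ≋-reflexive (cong (λ l → Q ⊛ S ⊕ polySum l) (map-∘ (upTo q))) ⟨
    Q ⊛ S ⊕ polySum (map (λ i → X^ (p * i % q)) (upTo q))
      ≈⟨ sum-linear Q (λ i → Σ[1,≤ ⌊ p * i / q ⌋ ] (λ j → X^ (p * i ∸ q * j))) (λ i → X^ (p * i % q)) (λ i → X^ (p * i)) (λ i → inner-sum (p * i)) (upTo q) ⟩
    H                                                           ∎
    where open ≋-Reasoning

  -- A geometric series of `q` terms with ratio X^p, here with the ascending form of `telescope`.
  outer-sum : P ⊛ H ⊕ one ≋ X^ (p * q)
  outer-sum = begin
    P ⊛ H ⊕ one          ≈⟨ ≋-reflexive (cong (λ k → P ⊛ H ⊕ X^ k) (ℕ.*-zeroʳ p)) ⟨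
    P ⊛ H ⊕ X^ (p * 0)   ≈⟨ telescope P [] (λ i → X^ (p * i)) (λ i → X^ (p * i)) q (λ i _ → step i) ⟩
    X^ (p * q)           ∎
    where
    open ≋-Reasoning
    step : ∀ i → P ⊛ X^ (p * i) ⊕ X^ (p * i) ≋ X^ (p * suc i)
    step i = ≋-trans (⊛-X^ P p (p * i) (geom-telescope p)) (≋-reflexive (cong X^ (sym (ℕ.*-suc p i))))

  -- The three successors are the levels of fuel consumed by `p * q`, by the primes and by 1;
  -- `cyc-prime` holds for whatever surplus `f` remains.
  Φ-prime*prime : ∀ f → 3 + f ≡ p * q → Φ (p * q) ≋ one ⊕ u ⊛ S
  Φ-prime*prime f 3+f≡pq = ≋-trans (≋-reflexive (trans (cong Φ (sym 3+f≡pq)) (Φ-suc (2 + f))))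
    (divMonic-exact _ _ (one ⊕ u ⊛ S) (Monic-resp-≋ denominator monic) (⊕-cancelʳ one (begin
      (X^ (3 + f) ⊖ one) ⊕ one                         ≈⟨ ⊖-⊕ (X^ (3 + f)) one ⟩
      X^ (3 + f)                                       ≈⟨ ≋-reflexive (cong X^ 3+f≡pq) ⟩
      X^ (p * q)                                       ≈⟨ outer-sum ⟨
      P ⊛ H ⊕ one                                      ≈⟨ ⊕-congʳ one (⊛-congˡ P double-sum) ⟨
      P ⊛ (Q ⊛ S ⊕ geom q) ⊕ one                       ≈⟨ ⊕-congʳ one rearrange ⟩
      (u ⊛ (geom q ⊛ (geom p ⊛ one))) ⊛ (one ⊕ u ⊛ S) ⊕ one
        ≈⟨ ⊕-congʳ one (⊛-congʳ (one ⊕ u ⊛ S) denominator) ⟨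
      polyProd (map (cyc (2 + f)) (properDivisors (3 + f))) ⊛ (one ⊕ u ⊛ S) ⊕ one ∎)))
    where
    open ≋-Reasoning
    divisors : properDivisors (3 + f) ↭ 1 ∷ q ∷ p ∷ []
    divisors = subst (λ n → properDivisors n ↭ 1 ∷ q ∷ p ∷ []) (sym 3+f≡pq) (properDivisors-prime*prime pp pq q<p)
    denominator : polyProd (map (cyc (2 + f)) (properDivisors (3 + f))) ≋ u ⊛ (geom q ⊛ (geom p ⊛ one))
    denominator = ≋-trans (foldr-map-↭ ⊛-isCommutativeMonoid (cyc (2 + f)) divisors)
      (⊛-congˡ u (⊛-cong (cyc-prime f pq) (⊛-congʳ one (cyc-prime f pp))))
    monic : Monic (u ⊛ (geom q ⊛ (geom p ⊛ one)))
    monic = Monic-⊛ Monic-X⊖one (Monic-⊛ (Monic-geom⁺ q) (Monic-⊛ (Monic-geom⁺ p) Monic-one))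
      where
      Monic-geom⁺ : ∀ n .{{_ : NonZero n}} → Monic (geom n)
      Monic-geom⁺ (suc n) = Monic-geom n
    rearrange : P ⊛ (Q ⊛ S ⊕ geom q) ≋ (u ⊛ (geom q ⊛ (geom p ⊛ one))) ⊛ (one ⊕ u ⊛ S)
    rearrange = solve 4 (λ u g h s → (u :* h) :* (u :* g :* s :+ g) := (u :* (g :* (h :* con 1))) :* (con 1 :+ u :* s))
      ≋-refl u (geom q) (geom p) S
      where open Solver

theorem2 : (p q : ℕ) → Prime p → Prime q → p > q →
    Φ (p * q) ≈ₚ one ⊕ (X ⊖ one) ⊛ Σ[0,< q ] (λ i → Σ[1,≤ ⌊ p * i / q ⌋ ] (λ j → X^ (p * i ∸ q * j)))
theorem2 p q pp pq q<p = at (Φ-prime*prime p q pp pq q<p (p * q ∸ 3) (ℕ.m+[n∸m]≡n 3≤pq))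
  where
  3≤pq : 3 ≤ p * q
  3≤pq = ℕ.≤-trans (s≤s (prime>1 pq)) (ℕ.≤-trans q<p (ℕ.m≤m*n p q {{prime⇒nonZero pq}}))
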